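{- Let $n\ge3$ and let $x\in B$ with $|x|=2n+9$ and $\delta(x)\ge5$. Then $[x]_2\notin R$.
   Context: Stern's sequence $(a(n))_{n\ge0}$: $a(0)=0$, $a(1)=1$, $a(2n)=a(n)$, $a(2n+1)=a(n)+a(n+1)$; $s(n)=a(n+1)$. $R$ is the set of record-setters of $s$, i.e. indices $v\ge0$ with $s(i)<s(v)$ for all $i<v$. For a binary string $x$, $[x]_2$ is the integer it represents in base 2 and $|x|$ its length. $B$ denotes the set of nonempty binary strings that are concatenations of blocks each equal to $10$ or $100$; for $x\in B$, $\delta(x)$ is the number of $0$s minus the number of $1$s in $x$, which equals the number of $100$ blocks. -}

module Defs where

open import Data.Digit using (Bit; 0b; 1b; fromDigits)
open import Data.Fin.Properties using () renaming (_≟_ to _≟ᵇ_)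
open import Data.Integer.Base using (ℤ; _⊖_)
open import Data.List.Base using (List; []; _∷_; length; filter; concat; reverse)
open import Data.List.Relation.Unary.All using (All)
open import Data.Nat.Base using (ℕ; zero; suc; 2+; _+_; _*_; _<_; ⌊_/2⌋; ⌈_/2⌉; parity)
open import Data.Nat.Induction using (<-rec; <-Rec; <-wellFounded)
open import Data.Nat.Properties using (⌊n/2⌋<n; ⌈n/2⌉<n; n≡⌊n+n/2⌋; n≡⌈n+n/2⌉; +-suc; +-identityʳ)
open import Data.Parity.Base using (0ℙ; 1ℙ)
open import Data.Product.Base using (_×_; ∃-syntax)
open import Data.Sum.Base using (_⊎_)
open import Induction.WellFounded using (module FixPoint)
open import Level using (0ℓ)
open import Relation.Binary.PropositionalEquality using (_≡_; _≢_; refl; sym; trans; cong; cong₂)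
open import Relation.Unary using (Pred)

-- The odd clause uses n = ⌊ (2n+1) /2⌋ and n+1 = ⌈ (2n+1) /2⌉; the
-- recurrences in their usual form are a-even and a-odd below.
a-step : ∀ n → <-Rec (λ _ → ℕ) n → ℕ
a-step 0      rec = 0
a-step 1      rec = 1
a-step (2+ k) rec with parity k
... | 0ℙ = rec (⌊n/2⌋<n (suc k))
... | 1ℙ = rec (⌊n/2⌋<n (suc k)) + rec (⌈n/2⌉<n k)

a : ℕ → ℕ
a = <-rec (λ _ → ℕ) a-step

private
  a-step-ext : ∀ n {f g : <-Rec (λ _ → ℕ) n} →
               (∀ {m} m<n → f {m} m<n ≡ g m<n) → a-step n f ≡ a-step n g
  a-step-ext 0      f≗g = refl
  a-step-ext 1      f≗g = refl
  a-step-ext (2+ k) f≗g with parity k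
  ... | 0ℙ = f≗g _
  ... | 1ℙ = cong₂ _+_ (f≗g _) (f≗g _)

  a-unfold : ∀ n → a n ≡ a-step n (λ {m} _ → a m)
  a-unfold n = FixPoint.unfold-wfRec <-wellFounded (λ _ → ℕ) a-step a-step-ext {n}

  parity-n+n : ∀ n → parity (n + n) ≡ 0ℙ
  parity-n+n zero    = refl
  parity-n+n (suc n) rewrite +-suc n n = parity-n+n n

  parity-1+n+n : ∀ n → parity (suc (n + n)) ≡ 1ℙ
  parity-1+n+n zero    = refl
  parity-1+n+n (suc n) rewrite +-suc n n = parity-1+n+n n

  a-step-even : ∀ k → parity k ≡ 0ℙ → a (2+ k) ≡ a ⌊ 2+ k /2⌋
  a-step-even k eq with a-unfold (2+ k)
  ... | p rewrite eq = p

  a-step-odd : ∀ k → parity k ≡ 1ℙ → a (2+ k) ≡ a ⌊ 2+ k /2⌋ + a ⌈ 2+ k /2⌉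
  a-step-odd k eq with a-unfold (2+ k)
  ... | p rewrite eq = p

  ⌊1+n+n/2⌋≡n : ∀ n → ⌊ suc (n + n) /2⌋ ≡ n
  ⌊1+n+n/2⌋≡n n = sym (n≡⌈n+n/2⌉ n)

  a-n+n : ∀ n → a (n + n) ≡ a n
  a-n+n zero    = refl
  a-n+n (suc n) rewrite +-suc n n =
    trans (a-step-even (n + n) (parity-n+n n)) (cong (λ m → a (suc m)) (sym (n≡⌊n+n/2⌋ n)))

  a-n+n+1 : ∀ n → a (suc (n + n)) ≡ a n + a (suc n)
  a-n+n+1 zero    = refl
  a-n+n+1 (suc n) rewrite +-suc n n =
    trans (a-step-odd (suc (n + n)) (parity-1+n+n n))
          (cong₂ (λ i j → a (suc i) + a (2+ j)) (⌊1+n+n/2⌋≡n n) (sym (n≡⌊n+n/2⌋ n)))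

a-zero : a 0 ≡ 0
a-zero = refl

a-one : a 1 ≡ 1
a-one = refl

a-even : ∀ n → a (2 * n) ≡ a n
a-even n rewrite +-identityʳ n = a-n+n n

a-odd : ∀ n → a (2 * n + 1) ≡ a n + a (n + 1)
a-odd n rewrite +-identityʳ n | +-suc (n + n) 0 | +-identityʳ (n + n)
              | +-suc n 0 | +-identityʳ n = a-n+n+1 n

s : ℕ → ℕ
s n = a (n + 1)

R : Pred ℕ 0ℓ
R v = ∀ i → i < v → s i < s v

-- Written with the most significant bit first.
BinaryString : Set
BinaryString = List Bit

-- fromDigits reads the least significant digit first, hence the reversal.
[_]₂ : BinaryString → ℕ
[ x ]₂ = fromDigits (reverse x)

IsBlock : Pred BinaryString 0ℓ
IsBlock b = b ≡ 1b ∷ 0b ∷ [] ⊎ b ≡ 1b ∷ 0b ∷ 0b ∷ []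

B : Pred BinaryString 0ℓ
B x = x ≢ [] × ∃[ bs ] All IsBlock bs × x ≡ concat bs

occurrences : Bit → BinaryString → ℕ
occurrences b x = length (filter (b ≟ᵇ_) x)

δ : BinaryString → ℤ
δ x = occurrences 0b x ⊖ occurrences 1b x

{-# OPTIONS --safe #-}

-- Reading a bit acts linearly on (a(m), a(m+1)).  With Q(a,b) = (b,a+b), the
-- block 10 acts as Q², and with H for the action of 100 one has, entrywise,
-- H Qᵐ H ≤ Qᵐ⁺⁶: replacing two 100 blocks by three 10 blocks never decreases s.
-- As |x| is odd, so is the number of 100 blocks.  If x starts with 100, the
-- first five of them already cost more than dropping one bit, so x is beaten by
-- (10)ⁿ⁺⁴; if x starts with 10, its first three 100 blocks cost more than a single
-- leading one, so x is beaten by 100(10)ⁿ⁺³.  Both costs are linear in each power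
-- of Q involved, so finitely many exponents suffice.

module Submission where

open import Defs using (R; BinaryString; [_]₂; B; δ; a; s; a-even; a-odd; IsBlock; occurrences)
open import Data.Digit using (Bit; 0b; 1b; fromDigits)
open import Data.Fin.Base using (zero; suc; toℕ)
open import Data.Fin.Properties using (toℕ≤pred[n])
open import Data.Integer.Base using (+_) renaming (_≥_ to _≥ᶻ_)
open import Data.Integer.Properties using (⊖-≥; drop‿+≤+)
open import Data.List.Base using (List; []; _∷_; _++_; length; concat; foldl)
open import Data.List.Properties using (length-++; ++-identityʳ)
open import Data.List.Relation.Unary.All using (All; []; _∷_)
open import Data.Nat.Base using (ℕ; zero; suc; _+_; _*_; _∸_; _≤_; _<_; _≥_; z≤n; s≤s)
open import Data.Nat.ListAction using (sum)
open import Data.Nat.Properties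
open import Data.Nat.Tactic.RingSolver using (solve-∀)
open import Data.Product.Base using (_×_; _,_; proj₁; proj₂; ∃-syntax)
open import Data.Sum.Base using (_⊎_; inj₁; inj₂)
open import Data.Unit.Base using (tt)
open import Function.Base using (_∘_; flip; id)
open import Relation.Binary.PropositionalEquality using (_≡_; refl; sym; trans; cong; cong₂; subst; subst₂; module ≡-Reasoning)
open import Relation.Nullary.Decidable using (Dec; _×-dec_; toWitness)
open import Relation.Nullary.Negation using (¬_; contradiction)
open import Relation.Unary using (_∈_; _∉_)

-- Pairs of naturals and additive maps

V : Set
V = ℕ × ℕ

infixl 6 _⊕_
infix 4 _≼_ _≼?_

_⊕_ : V → V → V
(a , b) ⊕ (c , d) = a + c , b + d

_≼_ : V → V → Set
(a , b) ≼ (c , d) = a ≤ c × b ≤ d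

_≼?_ : ∀ u v → Dec (u ≼ v)
(a , b) ≼? (c , d) = (a ≤? c) ×-dec (b ≤? d)

≼-trans : ∀ {u v w} → u ≼ v → v ≼ w → u ≼ w
≼-trans (p , q) (p′ , q′) = ≤-trans p p′ , ≤-trans q q′

⊕-mono-≼ : ∀ {u u′ v v′} → u ≼ u′ → v ≼ v′ → u ⊕ v ≼ u′ ⊕ v′
⊕-mono-≼ (p , q) (p′ , q′) = +-mono-≤ p p′ , +-mono-≤ q q′

record Additive (f : V → V) : Set where
  constructor additive
  field homo : ∀ u v → f (u ⊕ v) ≡ f u ⊕ f v

open Additive

additive-id : Additive id
additive-id = additive λ _ _ → refl

additive-∘ : ∀ {f g} → Additive f → Additive g → Additive (f ∘ g)
additive-∘ {f} f-add g-add = additive λ u v → trans (cong f (homo g-add u v)) (homo f-add _ _)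

-- The order is the one induced by addition: `v` is `u ⊕ w` for the difference `w`, and `f w` can
-- only add.
additive⇒mono : ∀ {f} → Additive f → ∀ {u v} → u ≼ v → f u ≼ f v
additive⇒mono {f} f-add {u} {v} (p , q) =
  subst (f u ≼_) (trans (sym (homo f-add u w)) (cong f u⊕w≡v)) (m≤m+n _ _ , m≤m+n _ _)
  where
  w : V
  w = proj₁ v ∸ proj₁ u , proj₂ v ∸ proj₂ u
  u⊕w≡v : u ⊕ w ≡ v
  u⊕w≡v = cong₂ _,_ (m+[n∸m]≡n p) (m+[n∸m]≡n q)

-- Every pair is a sum of basis pairs, so two 2×2 matrices are compared here column by column.
additive-≼ : ∀ {f g} → Additive f → Additive g →
             f (1 , 0) ≼ g (1 , 0) → f (0 , 1) ≼ g (0 , 1) → ∀ u → f u ≼ g u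
additive-≼ {f} {g} f-add g-add p q = go
  where
  x≡x+x⇒x≡0 : ∀ {x} → x ≡ x + x → x ≡ 0
  x≡x+x⇒x≡0 {x} eq = sym (+-cancelˡ-≡ x 0 x (trans (+-identityʳ x) eq))

  step : ∀ u v → f u ≼ g u → f v ≼ g v → f (u ⊕ v) ≼ g (u ⊕ v)
  step u v p q = subst₂ _≼_ (sym (homo f-add u v)) (sym (homo g-add u v)) (⊕-mono-≼ p q)

  go : ∀ u → f u ≼ g u
  go (suc a , b)    = step (1 , 0) (a , b) p (go (a , b))
  go (zero , suc b) = step (0 , 1) (0 , b) q (go (0 , b))
  -- `Additive` has no clause for zero; that `f` and `g` vanish there comes from cancelling in 0 = 0
  -- + 0.
  go (zero , zero)  =
    ≤-trans (≤-reflexive (x≡x+x⇒x≡0 (cong proj₁ (homo f-add (0 , 0) (0 , 0))))) z≤n ,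
    ≤-trans (≤-reflexive (x≡x+x⇒x≡0 (cong proj₂ (homo f-add (0 , 0) (0 , 0))))) z≤n

-- Action of bits and blocks on pairs

read : Bit → V → V
read zero       (a , b) = a , a + b
read (suc zero) (a , b) = a + b , b

Q : V → V
Q (a , b) = b , a + b

H : V → V
H = read 0b ∘ read 0b ∘ read 1b

Q^ : ℕ → V → V
Q^ zero    u = u
Q^ (suc m) u = Q (Q^ m u)

interchange : ∀ a b c d → (a + b) + (c + d) ≡ (a + c) + (b + d)
interchange = solve-∀

read-additive : ∀ b → Additive (read b)
read-additive zero       = additive λ (a , b) (c , d) → cong (a + c ,_) (interchange a c b d)
read-additive (suc zero) = additive λ (a , b) (c , d) → cong (_, b + d) (interchange a c b d)

Q-additive : Additive Q
Q-additive = additive λ (a , b) (c , d) → cong (b + d ,_) (interchange a c b d)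

H-additive : Additive H
H-additive = additive-∘ (read-additive 0b) (additive-∘ (read-additive 0b) (read-additive 1b))

Q^-additive : ∀ m → Additive (Q^ m)
Q^-additive zero    = additive-id
Q^-additive (suc m) = additive-∘ Q-additive (Q^-additive m)

Q^-+ : ∀ m n u → Q^ (m + n) u ≡ Q^ m (Q^ n u)
Q^-+ zero    n u = refl
Q^-+ (suc m) n u = cong Q (Q^-+ m n u)

Q^2*suc : ∀ g u → Q^ (2 * g) (Q^ 2 u) ≡ Q^ (2 * suc g) u
Q^2*suc g u = trans (sym (Q^-+ (2 * g) 2 u)) (cong (λ m → Q^ m u) (exponent g))
  where
  exponent : ∀ g → 2 * g + 2 ≡ 2 * suc g
  exponent = solve-∀

-- Q² = Q + 1 makes both sides Fibonacci-like sequences in m.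
additive-Q^-≼ : ∀ {f g} → Additive f → Additive g → ∀ {u v} →
                f u ≼ g v → f (Q u) ≼ g (Q v) → ∀ m → f (Q^ m u) ≼ g (Q^ m v)
additive-Q^-≼ {f} {g} f-add g-add {u} {v} p₀ p₁ = go
  where
  Q²≡Q+1 : ∀ w → Q (Q w) ≡ Q w ⊕ w
  Q²≡Q+1 (a , b) = cong₂ _,_ (+-comm a b) (+-comm b (a + b))

  recurrence : ∀ {h} → Additive h → ∀ w → h (Q w) ⊕ h w ≡ h (Q (Q w))
  recurrence {h} h-add w = sym (trans (cong h (Q²≡Q+1 w)) (homo h-add (Q w) w))

  go : ∀ m → f (Q^ m u) ≼ g (Q^ m v)
  go zero          = p₀
  go (suc zero)    = p₁
  go (suc (suc m)) = subst₂ _≼_ (recurrence f-add _) (recurrence g-add _)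
                       (⊕-mono-≼ (go (suc m)) (go m))

-- Products of Q²ᵍ and H

-- Each entry counts the 10 blocks directly before one 100 block. The head acts first, since strings
-- are read from the left.
runs : List ℕ → V → V
runs []       u = u
runs (g ∷ gs) u = runs gs (H (Q^ (2 * g) u))

runs-additive : ∀ gs → Additive (runs gs)
runs-additive []       = additive-id
runs-additive (g ∷ gs) =
  additive-∘ (runs-additive gs) (additive-∘ H-additive (Q^-additive (2 * g)))

-- Every Q²ᵍ is 1 or a nonnegative combination of Q² and Q³; the vertex Q in
-- place of the latter two would be too crude for the check in runs₅-≼.
Vertices : ℕ → V → V → Set
Vertices zero    u v = u ≼ v
Vertices (suc k) u v =
  Vertices k (H u) v × Vertices k (H (Q^ 2 u)) (Q^ 2 v) × Vertices k (H (Q^ 3 u)) (Q^ 3 v)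

vertices? : ∀ k u v → Dec (Vertices k u v)
vertices? zero    u v = u ≼? v
vertices? (suc k) u v = vertices? k _ _ ×-dec vertices? k _ _ ×-dec vertices? k _ _

-- For a positive gap the exponent is m + 2 with m even, and the cases m = 0 and m = 1 give all m by
-- `additive-Q^-≼`. On the right there are only powers of `Q`, so the power belonging to any gap may
-- be applied first.
runs-≼ : ∀ gs {u v} → Vertices (length gs) u v → runs gs u ≼ Q^ (2 * sum gs) v
runs-≼ []       p = p
runs-≼ (zero ∷ gs) (p , _) = runs-≼ gs p
runs-≼ (suc g ∷ gs) {u} {v} (_ , p₂ , p₃) = subst₂ _≼_ lhs rhs
  (additive-Q^-≼ (additive-∘ (runs-additive gs) H-additive) (Q^-additive (2 * sum gs))
    (runs-≼ gs p₂) (runs-≼ gs p₃) (2 * g))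
  where
  lhs : runs gs (H (Q^ (2 * g) (Q^ 2 u))) ≡ runs gs (H (Q^ (2 * suc g) u))
  lhs = cong (λ w → runs gs (H w)) (Q^2*suc g u)

  exponent : ∀ S g → 2 * S + (2 * g + 2) ≡ 2 * (suc g + S)
  exponent = solve-∀

  rhs : Q^ (2 * sum gs) (Q^ (2 * g) (Q^ 2 v)) ≡ Q^ (2 * sum (suc g ∷ gs)) v
  rhs = begin
    Q^ (2 * sum gs) (Q^ (2 * g) (Q^ 2 v)) ≡⟨ cong (Q^ (2 * sum gs)) (Q^-+ (2 * g) 2 v) ⟨
    Q^ (2 * sum gs) (Q^ (2 * g + 2) v)    ≡⟨ Q^-+ (2 * sum gs) (2 * g + 2) v ⟨
    Q^ (2 * sum gs + (2 * g + 2)) v       ≡⟨ cong (λ m → Q^ m v) (exponent (sum gs) g) ⟩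
    Q^ (2 * sum (suc g ∷ gs)) v           ∎
    where open ≡-Reasoning

-- Five 100 blocks take 15 bits, and the exponent 14 accounts for the dropped bit. The pair
-- `(0 , 1)` is `stern 0`. The check consists of 81 comparisons.
runs₅-≼ : ∀ g₁ g₂ g₃ g₄ →
  runs (0 ∷ g₁ ∷ g₂ ∷ g₃ ∷ g₄ ∷ []) (0 , 1) ≼ Q^ (2 * sum (g₁ ∷ g₂ ∷ g₃ ∷ g₄ ∷ [])) (Q^ 14 (0 , 1))
runs₅-≼ g₁ g₂ g₃ g₄ =
  runs-≼ (g₁ ∷ g₂ ∷ g₃ ∷ g₄ ∷ []) (toWitness {a? = vertices? 4 (H (0 , 1)) (Q^ 14 (0 , 1))} tt)

-- The leading 10 and three 100 blocks take 11 bits, as many as the leading 100 of the competitor,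
-- which gives `H (0 , 1)`, followed by `Q^ 8`. Here 27 comparisons suffice.
runs₃-≼ : ∀ g₀ g₁ g₂ →
  runs (suc g₀ ∷ g₁ ∷ g₂ ∷ []) (0 , 1) ≼ Q^ (2 * sum (g₀ ∷ g₁ ∷ g₂ ∷ [])) (Q^ 8 (H (0 , 1)))
runs₃-≼ g₀ g₁ g₂ = subst
  (λ w → runs (g₁ ∷ g₂ ∷ []) (H w) ≼ Q^ (2 * sum (g₀ ∷ g₁ ∷ g₂ ∷ [])) (Q^ 8 (H (0 , 1))))
  (Q^2*suc g₀ (0 , 1))
  (runs-≼ (g₀ ∷ g₁ ∷ g₂ ∷ []) (toWitness {a? = vertices? 3 (Q^ 2 (0 , 1)) (Q^ 8 (H (0 , 1)))} tt))

-- Two 100 blocks and three 10 blocks both have six bits. The Fibonacci recurrence leaves m = 0 and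
-- m = 1, and additivity leaves the two basis pairs.
HQᵐH≼Qᵐ⁺⁶ : ∀ m u → H (Q^ m (H u)) ≼ Q^ m (Q^ 6 u)
HQᵐH≼Qᵐ⁺⁶ m u = additive-Q^-≼ H-additive additive-id
  (additive-≼ (additive-∘ H-additive H-additive) (Q^-additive 6)
    (toWitness {a? = _ ≼? _} tt) (toWitness {a? = _ ≼? _} tt) u)
  (additive-≼ (additive-∘ H-additive (additive-∘ Q-additive H-additive)) (Q^-additive 7)
    (toWitness {a? = _ ≼? _} tt) (toWitness {a? = _ ≼? _} tt) u) m

-- Pairing off the 100 blocks

data EvenLength : List ℕ → Set where
  []  : EvenLength []
  2+_ : ∀ {g h gs} → EvenLength gs → EvenLength (g ∷ h ∷ gs)

evenLength-or-∷ : ∀ g gs → EvenLength gs ⊎ EvenLength (g ∷ gs)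
evenLength-or-∷ g []       = inj₁ []
evenLength-or-∷ g (h ∷ gs) with evenLength-or-∷ h gs
... | inj₁ e = inj₂ (2+ e)
... | inj₂ e = inj₁ e

width : List ℕ → ℕ
width []       = 0
width (g ∷ gs) = 2 * g + 3 + width gs

evenLength⇒width-even : ∀ {gs} → EvenLength gs → ∃[ m ] width gs ≡ 2 * m
evenLength⇒width-even [] = 0 , refl
evenLength⇒width-even (2+_ {g} {h} e) with evenLength⇒width-even e
... | m , eq = g + h + 3 + m ,
  trans (cong (λ w → 2 * g + 3 + (2 * h + 3 + w)) eq) (regroup g h m)
  where
  regroup : ∀ g h m → 2 * g + 3 + (2 * h + 3 + 2 * m) ≡ 2 * (g + h + 3 + m)
  regroup = solve-∀

-- Consecutive 100 blocks are replaced in pairs by `HQᵐH≼Qᵐ⁺⁶`. Each replacement keeps the number of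
-- bits, so the final exponent is the total width.
runs-even-≼ : ∀ {gs} → EvenLength gs → ∀ u → runs gs u ≼ Q^ (width gs) u
runs-even-≼ [] u = ≤-refl , ≤-refl
runs-even-≼ (2+_ {g} {h} {gs} e) u = subst (runs (g ∷ h ∷ gs) u ≼_) collect
  (≼-trans (additive⇒mono (runs-additive gs) (HQᵐH≼Qᵐ⁺⁶ (2 * h) (Q^ (2 * g) u)))
           (runs-even-≼ e _))
  where
  exponent : ∀ w g h → w + (2 * h + (6 + 2 * g)) ≡ 2 * g + 3 + (2 * h + 3 + w)
  exponent = solve-∀

  collect : Q^ (width gs) (Q^ (2 * h) (Q^ 6 (Q^ (2 * g) u))) ≡ Q^ (width (g ∷ h ∷ gs)) u
  collect = begin
    Q^ (width gs) (Q^ (2 * h) (Q^ (6 + 2 * g) u)) ≡⟨ cong (Q^ (width gs)) (Q^-+ (2 * h) (6 + 2 * g) u) ⟨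
    Q^ (width gs) (Q^ (2 * h + (6 + 2 * g)) u)    ≡⟨ Q^-+ (width gs) _ u ⟨
    Q^ (width gs + (2 * h + (6 + 2 * g))) u       ≡⟨ cong (λ m → Q^ m u) (exponent (width gs) g h) ⟩
    Q^ (width (g ∷ h ∷ gs)) u                     ∎
    where open ≡-Reasoning

-- Strings of blocks

tens : ℕ → BinaryString
tens zero    = []
tens (suc t) = 1b ∷ 0b ∷ tens t

bits : List ℕ → ℕ → BinaryString
bits []       t = tens t
bits (g ∷ gs) t = tens g ++ 1b ∷ 0b ∷ 0b ∷ bits gs t

blocks⇒bits : ∀ {bs} → All IsBlock bs → ∃[ gs ] ∃[ t ] concat bs ≡ bits gs t
blocks⇒bits [] = [] , 0 , refl
-- A 10 block lengthens the run before the next 100, or the final run if no 100 follows.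
blocks⇒bits (inj₁ refl ∷ bs) with blocks⇒bits bs
... | []     , t , eq = [] , suc t , cong (λ x → 1b ∷ 0b ∷ x) eq
... | g ∷ gs , t , eq = suc g ∷ gs , t , cong (λ x → 1b ∷ 0b ∷ x) eq
blocks⇒bits (inj₂ refl ∷ bs) with blocks⇒bits bs
... | gs , t , eq = 0 ∷ gs , t , cong (λ x → 1b ∷ 0b ∷ 0b ∷ x) eq

length-tens : ∀ t → length (tens t) ≡ 2 * t
length-tens zero    = refl
length-tens (suc t) = trans (cong (λ m → suc (suc m)) (length-tens t)) (sym (*-suc 2 t))

length-bits : ∀ gs t → length (bits gs t) ≡ width gs + 2 * t
length-bits []       t = length-tens t
length-bits (g ∷ gs) t = begin
  length (bits (g ∷ gs) t)                     ≡⟨ length-++ (tens g) ⟩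
  length (tens g) + (3 + length (bits gs t))   ≡⟨ cong₂ (λ i j → i + (3 + j)) (length-tens g) (length-bits gs t) ⟩
  2 * g + (3 + (width gs + 2 * t))             ≡⟨ regroup g (width gs) t ⟩
  width (g ∷ gs) + 2 * t                       ∎
  where
  open ≡-Reasoning
  regroup : ∀ g w t → 2 * g + (3 + (w + 2 * t)) ≡ 2 * g + 3 + w + 2 * t
  regroup = solve-∀

occurrences-tens-++ : ∀ t {k x} → occurrences 0b x ≡ occurrences 1b x + k →
                      occurrences 0b (tens t ++ x) ≡ occurrences 1b (tens t ++ x) + k
occurrences-tens-++ zero    eq = eq
occurrences-tens-++ (suc t) eq = cong suc (occurrences-tens-++ t eq)

-- A 10 block is balanced, and a 100 block has one surplus zero.
occurrences-bits : ∀ gs t → occurrences 0b (bits gs t) ≡ occurrences 1b (bits gs t) + length gs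
occurrences-bits []       zero    = refl
occurrences-bits []       (suc t) = cong suc (occurrences-bits [] t)
occurrences-bits (g ∷ gs) t       = occurrences-tens-++ g
  (cong suc (trans (cong suc (occurrences-bits gs t)) (sym (+-suc _ _))))

δ-bits : ∀ gs t → δ (bits gs t) ≡ + length gs
δ-bits gs t rewrite occurrences-bits gs t =
  trans (⊖-≥ (m≤m+n m _)) (cong +_ (m+n∸m≡n m (length gs)))
  where
  m : ℕ
  m = occurrences 1b (bits gs t)

-- Values of strings and Stern's sequence

-- The accumulator is the integer read so far, so arguments can start after any prefix. The form
-- `m * 2` matches `fromDigits` by computation.
value : ℕ → BinaryString → ℕ
value m []      = m
value m (b ∷ x) = value (toℕ b + m * 2) x

[]₂≡value : ∀ x → [ x ]₂ ≡ value 0 x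
[]₂≡value = go []
  where
  go : ∀ acc x → fromDigits (foldl (flip _∷_) acc x) ≡ value (fromDigits acc) x
  go acc []      = refl
  go acc (b ∷ x) = go (b ∷ acc) x

-- One more bit turns `m` into at most 2m + 1, which is still below 2n.
value-mono-< : ∀ {m n} x y → length x ≡ length y → m < n → value m x < value n y
value-mono-< []      []      eq m<n = m<n
value-mono-< {m} {n} (b ∷ x) (c ∷ y) eq m<n = value-mono-< x y (suc-injective eq)
  (begin-strict
    toℕ b + m * 2 <⟨ s≤s (+-monoˡ-≤ (m * 2) (toℕ≤pred[n] b)) ⟩
    suc m * 2     ≤⟨ *-monoˡ-≤ 2 m<n ⟩
    n * 2         ≤⟨ m≤n+m (n * 2) (toℕ c) ⟩
    toℕ c + n * 2 ∎)
  where open ≤-Reasoning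

stern : ℕ → V
stern m = a m , s m

readAll : BinaryString → V → V
readAll []      u = u
readAll (b ∷ x) u = readAll x (read b u)

stern-read : ∀ b m → stern (toℕ b + m * 2) ≡ read b (stern m)
stern-read zero m =
  cong₂ _,_ (trans (cong a (*-comm m 2)) (a-even m))
            (trans (cong (λ k → a (k + 1)) (*-comm m 2)) (a-odd m))
stern-read (suc zero) m =
  cong₂ _,_ (trans (cong a (odd m)) (a-odd m))
            (trans (cong a (even m)) (a-even (m + 1)))
  where
  odd : ∀ m → 1 + m * 2 ≡ 2 * m + 1
  odd = solve-∀
  even : ∀ m → 1 + m * 2 + 1 ≡ 2 * (m + 1)
  even = solve-∀

stern-value : ∀ m x → stern (value m x) ≡ readAll x (stern m)
stern-value m []      = refl
stern-value m (b ∷ x) = trans (stern-value _ x) (cong (readAll x) (stern-read b m))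

readAll-tens-++ : ∀ t x u → readAll (tens t ++ x) u ≡ readAll x (Q^ (2 * t) u)
readAll-tens-++ zero    x u       = refl
readAll-tens-++ (suc t) x (a , b) = begin
  readAll (tens t ++ x) (a + b , a + b + b) ≡⟨ cong (λ c → readAll (tens t ++ x) (a + b , c)) (+-comm (a + b) b) ⟩
  readAll (tens t ++ x) (Q^ 2 (a , b))      ≡⟨ readAll-tens-++ t x _ ⟩
  readAll x (Q^ (2 * t) (Q^ 2 (a , b)))     ≡⟨ cong (readAll x) (Q^2*suc t (a , b)) ⟩
  readAll x (Q^ (2 * suc t) (a , b))        ∎
  where open ≡-Reasoning

readAll-tens : ∀ t u → readAll (tens t) u ≡ Q^ (2 * t) u
readAll-tens t u = trans (cong (λ x → readAll x u) (sym (++-identityʳ (tens t)))) (readAll-tens-++ t [] u)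

readAll-bits : ∀ gs t u → readAll (bits gs t) u ≡ Q^ (2 * t) (runs gs u)
readAll-bits []       t u = readAll-tens t u
readAll-bits (g ∷ gs) t u = trans (readAll-tens-++ g _ u) (readAll-bits gs t _)

-- Beating a string by a smaller one

not-record : ∀ x y → value 0 y < value 0 x → readAll x (0 , 1) ≼ readAll y (0 , 1) → [ x ]₂ ∉ R
not-record x y y<x (_ , x≼y) x∈R = <⇒≱ (subst R ([]₂≡value x) x∈R (value 0 y) y<x)
  (subst₂ _≤_ (cong proj₂ (sym (stern-value 0 x))) (cong proj₂ (sym (stern-value 0 y))) x≼y)

-- Only `gs` needs its own estimate: the 100 blocks of `hs` go in pairs, and the final run is
-- already a power of `Q`.
readAll-bits-≼ : ∀ gs {hs} t {k v} → EvenLength hs → runs gs (0 , 1) ≼ Q^ k v →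
                 readAll (bits (gs ++ hs) t) (0 , 1) ≼ Q^ (2 * t + (width hs + k)) v
readAll-bits-≼ gs {hs} t {k} {v} e p = subst₂ _≼_ lhs rhs
  (additive⇒mono (Q^-additive (2 * t))
    (≼-trans (additive⇒mono (runs-additive hs) p) (runs-even-≼ e _)))
  where
  runs-++ : ∀ gs hs u → runs (gs ++ hs) u ≡ runs hs (runs gs u)
  runs-++ []       hs u = refl
  runs-++ (g ∷ gs) hs u = runs-++ gs hs _

  lhs : Q^ (2 * t) (runs hs (runs gs (0 , 1))) ≡ readAll (bits (gs ++ hs) t) (0 , 1)
  lhs = sym (trans (readAll-bits (gs ++ hs) t _) (cong (Q^ (2 * t)) (runs-++ gs hs _)))

  rhs : Q^ (2 * t) (Q^ (width hs) (Q^ k v)) ≡ Q^ (2 * t + (width hs + k)) v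
  rhs = sym (trans (Q^-+ (2 * t) (width hs + k) v) (cong (Q^ (2 * t)) (Q^-+ (width hs) k v)))

2n+9≡1+2[n+4] : ∀ n → 2 * n + 9 ≡ suc (2 * (n + 4))
2n+9≡1+2[n+4] = solve-∀

leading-100 : ∀ n g₁ g₂ g₃ g₄ {hs} t → EvenLength hs →
              let x = bits (0 ∷ g₁ ∷ g₂ ∷ g₃ ∷ g₄ ∷ hs) t in
              length x ≡ 2 * n + 9 → [ x ]₂ ∉ R
leading-100 n g₁ g₂ g₃ g₄ {hs} t e len = not-record x (tens (n + 4))
  -- Without its leading 1, `x` is as long as the competitor, so prefix 0 meets prefix 1.
  (value-mono-< {0} {1} (tens (n + 4)) (0b ∷ 0b ∷ bits gs t) lengths (s≤s z≤n))
  (subst (readAll x (0 , 1) ≼_)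
    (trans (sym (Q^-+ E 14 (0 , 1)))
      (trans (cong (λ m → Q^ m (0 , 1)) exponents) (sym (readAll-tens (n + 4) (0 , 1)))))
    (readAll-bits-≼ (0 ∷ g₁ ∷ g₂ ∷ g₃ ∷ g₄ ∷ []) t e (runs₅-≼ g₁ g₂ g₃ g₄)))
  where
  gs : List ℕ
  gs = g₁ ∷ g₂ ∷ g₃ ∷ g₄ ∷ hs
  x : BinaryString
  x = bits (0 ∷ gs) t
  E : ℕ
  E = 2 * t + (width hs + 2 * sum (g₁ ∷ g₂ ∷ g₃ ∷ g₄ ∷ []))

  lengths : length (tens (n + 4)) ≡ length (0b ∷ 0b ∷ bits gs t)
  lengths = trans (length-tens (n + 4)) (sym (suc-injective (trans len (2n+9≡1+2[n+4] n))))

  regroup : ∀ g₁ g₂ g₃ g₄ w t →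
    suc (2 * t + (w + 2 * (g₁ + (g₂ + (g₃ + (g₄ + 0))))) + 14) ≡
    3 + (2 * g₁ + 3 + (2 * g₂ + 3 + (2 * g₃ + 3 + (2 * g₄ + 3 + w)))) + 2 * t
  regroup = solve-∀

  exponents : E + 14 ≡ 2 * (n + 4)
  exponents = suc-injective (trans (regroup g₁ g₂ g₃ g₄ (width hs) t)
    (trans (sym (length-bits (0 ∷ gs) t)) (trans len (2n+9≡1+2[n+4] n))))

leading-10 : ∀ n g₀ g₁ g₂ {hs} t → EvenLength hs →
             let x = bits (suc g₀ ∷ g₁ ∷ g₂ ∷ hs) t in
             length x ≡ 2 * n + 9 → [ x ]₂ ∉ R
leading-10 n g₀ g₁ g₂ {hs} t e len = not-record x y y<x
  (subst (readAll x (0 , 1) ≼_)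
    -- The pair `(1 , 3)` is `H (0 , 1)`, the effect of the leading 100 of `y`.
    (trans (sym (Q^-+ E 8 (1 , 3)))
      (trans (cong (λ m → Q^ m (1 , 3)) exponents) (sym (readAll-tens (n + 3) (1 , 3)))))
    (readAll-bits-≼ (suc g₀ ∷ g₁ ∷ g₂ ∷ []) t e (runs₃-≼ g₀ g₁ g₂)))
  where
  gs : List ℕ
  gs = g₁ ∷ g₂ ∷ hs
  x y z : BinaryString
  x = bits (suc g₀ ∷ gs) t
  y = 1b ∷ 0b ∷ 0b ∷ tens (n + 3)
  z = 0b ∷ 0b ∷ bits gs t
  E : ℕ
  E = 2 * t + (width hs + 2 * sum (g₀ ∷ g₁ ∷ g₂ ∷ []))

  2n+9 : ∀ n → 2 * n + 9 ≡ 3 + 2 * (n + 3)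
  2n+9 = solve-∀

  tens-++-1∷ : ∀ g z → ∃[ z′ ] tens g ++ 1b ∷ z ≡ 1b ∷ z′
  tens-++-1∷ zero    z = z , refl
  tens-++-1∷ (suc g) z = _ , refl

  y<x : value 0 y < value 0 x
  -- Whichever block follows the first 10, it starts with 1, so `x` begins with 101 and `y` with
  -- 100: prefixes 5 and 4.
  y<x with tens-++-1∷ g₀ z
  ... | z′ , eq = subst (λ w → value 0 y < value 0 (1b ∷ 0b ∷ w)) (sym eq)
    (value-mono-< {4} {5} (tens (n + 3)) z′ lengths ≤-refl)
    where
    lengths : length (tens (n + 3)) ≡ length z′
    lengths = trans (length-tens (n + 3)) (sym (+-cancelˡ-≡ 3 _ _
      (trans (cong (λ w → 2 + length w) (sym eq)) (trans len (2n+9 n)))))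

  regroup : ∀ g₀ g₁ g₂ w t →
    3 + (2 * t + (w + 2 * (g₀ + (g₁ + (g₂ + 0)))) + 8) ≡
    2 * suc g₀ + 3 + (2 * g₁ + 3 + (2 * g₂ + 3 + w)) + 2 * t
  regroup = solve-∀

  exponents : E + 8 ≡ 2 * (n + 3)
  exponents = +-cancelˡ-≡ 3 _ _ (trans (regroup g₀ g₁ g₂ (width hs) t)
    (trans (sym (length-bits (suc g₀ ∷ gs) t)) (trans len (2n+9 n))))

-- A pair of 100 blocks and any 10 block have even length, so an even number of 100 blocks would
-- make the length even.
odd-length : ∀ n gs t → length (bits gs t) ≡ 2 * n + 9 → ¬ EvenLength gs
odd-length n gs t len e with evenLength⇒width-even e
... | m , eq = even≢odd (m + t) (n + 4) (begin
  2 * (m + t)          ≡⟨ *-distribˡ-+ 2 m t ⟩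
  2 * m + 2 * t        ≡⟨ cong (_+ 2 * t) eq ⟨
  width gs + 2 * t     ≡⟨ length-bits gs t ⟨
  length (bits gs t)   ≡⟨ len ⟩
  2 * n + 9            ≡⟨ 2n+9≡1+2[n+4] n ⟩
  suc (2 * (n + 4))    ∎)
  where open ≡-Reasoning

bits-not-record : ∀ n gs t → length (bits gs t) ≡ 2 * n + 9 → 5 ≤ length gs → [ bits gs t ]₂ ∉ R
bits-not-record n (g₀ ∷ g₁ ∷ g₂ ∷ g₃ ∷ g₄ ∷ hs) t len _ with evenLength-or-∷ g₄ hs
bits-not-record n (zero   ∷ g₁ ∷ g₂ ∷ g₃ ∷ g₄ ∷ hs) t len _ | inj₁ e = leading-100 n g₁ g₂ g₃ g₄ t e len
-- Only three 100 blocks are spent on the start here; those of `g₃` and `g₄` join the even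
-- remainder.
bits-not-record n (suc g₀ ∷ g₁ ∷ g₂ ∷ g₃ ∷ g₄ ∷ hs) t len _ | inj₁ e = leading-10 n g₀ g₁ g₂ t (2+ e) len
bits-not-record n (g₀ ∷ g₁ ∷ g₂ ∷ g₃ ∷ g₄ ∷ hs) t len _ | inj₂ e = contradiction (2+ (2+ e)) (odd-length n (g₀ ∷ g₁ ∷ g₂ ∷ g₃ ∷ g₄ ∷ hs) t len)
bits-not-record n (_ ∷ _ ∷ _ ∷ _ ∷ []) t len (s≤s (s≤s (s≤s (s≤s ()))))
bits-not-record n (_ ∷ _ ∷ _ ∷ []) t len (s≤s (s≤s (s≤s ())))
bits-not-record n (_ ∷ _ ∷ []) t len (s≤s (s≤s ()))
bits-not-record n (_ ∷ []) t len (s≤s ())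

mainTheorem14 : (n : ℕ) → n ≥ 3 → (x : BinaryString) → x ∈ B → length x ≡ 2 * n + 9 → δ x ≥ᶻ + 5 → [ x ]₂ ∉ R
mainTheorem14 n _ x (_ , bs , blocks , refl) len 5≤δ with blocks⇒bits blocks
... | gs , t , eq rewrite eq =
  bits-not-record n gs t len (drop‿+≤+ (subst (_≥ᶻ + 5) (δ-bits gs t) 5≤δ))
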